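{- Let $(M,w)$ be a pointed Kripke model with yesterday and let $(U,s)$ be a pointed action model over $L_{\mathsf{DETL}}$ with $M,w\models\mathrm{pre}^U(s)$. (a) If $s$ is an epistemic past state, then $(M[U],(w,s))$ and $(M,w)$ satisfy the same $L_{\mathsf{DETL}}$-formulas. (b) If $(U,s)$ is past preserving, then there is a history $(w,s_0)\leadsto^{M[U]}(w,s_1)\leadsto^{M[U]}\cdots\leadsto^{M[U]}(w,s_n)=(w,s)$ in $M[U]$ such that $(M[U],(w,s_0))$ and $(M,w)$ satisfy the same $L_{\mathsf{DETL}}$-formulas.
   Context: Fix a nonempty finite set $\mathsf{Agt}$ of agents and a nonempty set $\mathsf{Prop}$ of propositional letters. A Kripke model (with yesterday) is $M=(W^M,(\to^M_a)_{a\in\mathsf{Agt}},\leadsto^M,V^M)$ with $W^M$ a nonempty set of worlds, binary relations $\to^M_a$ and $\leadsto^M$ on $W^M$ ($w'\leadsto^M w$: $w'$ is a yesterday of $w$), and $V^M:\mathsf{Prop}\to\mathcal P(W^M)$. For a set $F$ of formulas, an action model over $F$ is $U=(W^U,(\to^U_a)_a,\leadsto^U,\mathrm{pre}^U)$ with $W^U$ a nonempty finite set of events, binary relations $\to^U_a,\leadsto^U$ on $W^U$, $\mathrm{pre}^U:W^U\to F$; a pointed action model is $(U,s)$ with $s\in W^U$. An event $s$ is a past state if there is no $s'$ with $s'\leadsto^U s$. $L_{\mathsf{DETL}}$ and pointed action models over it are defined by simultaneous recursion: $\varphi::=p\mid\neg\varphi\mid\varphi\wedge\varphi\mid\Box_a\varphi\mid[Y]\varphi\mid[U,s]\varphi$.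 Semantics: Boolean standard; $M,w\models\Box_a\varphi$ iff $M,v\models\varphi$ for all $v$ with $w\to^M_av$; $M,w\models[Y]\varphi$ iff $M,v\models\varphi$ for all $v\leadsto^M w$; $M,w\models[U,s]\varphi$ iff $M,w\models\mathrm{pre}^U(s)$ implies $M[U],(w,s)\models\varphi$, where $M[U]$ has worlds $\{(v,t)\in W^M\times W^U:M,v\models\mathrm{pre}^U(t)\}$, $(v,t)\to_a(v',t')$ iff $v\to^M_av'$ and $t\to^U_at'$, $(v',t')\leadsto(v,t)$ iff ($v'\leadsto^Mv$, $t'=t$, $t$ a past state) or ($v'=v$ and $t'\leadsto^Ut$), and $(v,t)\in V(p)$ iff $v\in V^M(p)$. $\models\varphi$ means truth in all pointed Kripke models. An epistemic past state is a past state $s$ with $\models\mathrm{pre}^U(s)$ and whose only outgoing epistemic arrows are the reflexive arrows $s\to^U_a s$ for each $a\in\mathsf{Agt}$ (and these are present). A progression (in $U$ or in a Kripke model) is a finite nonempty sequence $x_0,\dots,x_n$ with $x_i\leadsto x_{i+1}$; a past-extension adds zero or more elements at the beginning (proper if at least one); a history is a progression with no proper past-extension. $U$ is history preserving if $s'\leadsto^Us$ implies $\models\mathrm{pre}^U(s)\to\mathrm{pre}^U(s')$, and every past state of $U$ is an epistemic past state. $(U,s)$ is past preserving if $U$ is history preserving and every progression ending at $s$ can be past-extended to a history beginning at an epistemic past state.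
   Formalization: In (b) the literal claim fails if w has a yesterday w' in M, since (w',s₀) ⇝ (w,s₀); so the sequence is proved to be a progression in M[U] whose events s₀,…,s_n form a history in U, and to be a history in M[U] when w has no yesterday. -}

module Defs where

open import Level using (Level; 0ℓ; _⊔_)
open import Data.Nat.Base using (suc)
open import Data.Fin.Base using (Fin)
open import Data.Product.Base using (∃-syntax; _×_; _,_; proj₁; proj₂)
open import Data.Sum.Base using (_⊎_)
open import Data.List.Base using ([])
open import Data.List.NonEmpty.Base using (List⁺; head; last; toList; _++⁺_)
open import Data.List.Relation.Unary.Linked using (Linked)
open import Data.Irrelevant using ([_])
open import Data.Refinement.Base using (Refinement; value; _,_)
open import Function.Bundles using (_↔_; _⇔_)
open import Relation.Binary.Core using (Rel)
open import Relation.Binary.PropositionalEquality.Core using (_≡_; _≢_)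
open import Relation.Nullary.Negation.Core using (¬_; Stable)

private
  variable
    a ℓ : Level
    A : Set a
    Agt Letter : Set

NonemptyFinite : Set a → Set a
NonemptyFinite A = ∃[ n ] (A ↔ Fin (suc n))

-- Nonemptiness of the set of worlds is not a field: a model is only ever used
-- together with one of its worlds.
--
-- V-stable holds of every subset in the sense of classical logic. It makes
-- truth of every formula stable under double negation, so that the connectives
-- have their classical meaning (in particular φ ⇒ ψ below is true exactly when
-- truth of φ implies truth of ψ).
record KripkeModel (Agt Letter : Set) : Set₁ where
  field
    World    : Set
    arrow    : Agt → Rel World 0ℓ
    yday     : Rel World 0ℓ        -- yday w' w : w' is a yesterday of w
    V        : Letter → World → Set
    V-stable : ∀ p w → Stable (V p w)

open KripkeModel public

record ActionModel (Agt : Set) (F : Set₁) : Set₁ where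
  field
    Event        : Set
    Event-finite : NonemptyFinite Event
    arrow        : Agt → Rel Event 0ℓ
    yday         : Rel Event 0ℓ
    pre          : Event → F

open ActionModel public using (Event; pre)
open ActionModel public using () renaming (arrow to arrowᵁ; yday to ydayᵁ)

infix  9 ~_
infixr 8 □ [Y]_ ⟦_,_⟧_
infixr 7 _∧_
infixr 6 _⇒_

data Form (Agt Letter : Set) : Set₁ where
  var    : Letter → Form Agt Letter
  ~_     : Form Agt Letter → Form Agt Letter
  _∧_    : Form Agt Letter → Form Agt Letter → Form Agt Letter
  □      : Agt → Form Agt Letter → Form Agt Letter
  [Y]_   : Form Agt Letter → Form Agt Letter
  ⟦_,_⟧_ : (U : ActionModel Agt (Form Agt Letter)) → Event U →
           Form Agt Letter → Form Agt Letter

_⇒_ : Form Agt Letter → Form Agt Letter → Form Agt Letter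
φ ⇒ ψ = ~ (φ ∧ ~ ψ)

module _ {F : Set₁} (U : ActionModel Agt F) where

  PastState : Event U → Set
  PastState s = ¬ (∃[ s' ] ydayᵁ U s' s)

-- M[U], relative to a relation P v t standing for M, v ⊨ pre t. The proof of P
-- in a world is irrelevant, so that worlds are equal as soon as the underlying
-- pairs are.
product : {F : Set₁} (M : KripkeModel Agt Letter) (U : ActionModel Agt F) →
          (World M → Event U → Set) → KripkeModel Agt Letter
product M U P = record
  { World    = Refinement (World M × Event U) (λ (v , t) → P v t)
  ; arrow    = λ a x y → arrow M a (world x) (world y) ×
                         arrowᵁ U a (event x) (event y)
  ; yday     = λ x' x →
      (yday M (world x') (world x) × event x' ≡ event x × PastState U (event x))
      ⊎ (world x' ≡ world x × ydayᵁ U (event x') (event x))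
  ; V        = λ p x → V M p (world x)
  ; V-stable = λ p x → V-stable M p (world x)
  }
  where
  world : Refinement (World M × Event U) (λ (v , t) → P v t) → World M
  world x = proj₁ (value x)
  event : Refinement (World M × Event U) (λ (v , t) → P v t) → Event U
  event x = proj₂ (value x)

infix 4 _∙_⊨_

_∙_⊨_ : (M : KripkeModel Agt Letter) → World M → Form Agt Letter → Set
M ∙ w ⊨ var p   = V M p w
M ∙ w ⊨ ~ φ     = ¬ (M ∙ w ⊨ φ)
M ∙ w ⊨ φ ∧ ψ   = (M ∙ w ⊨ φ) × (M ∙ w ⊨ ψ)
M ∙ w ⊨ □ a φ   = ∀ v → arrow M a w v → M ∙ v ⊨ φ
M ∙ w ⊨ [Y] φ   = ∀ v → yday M v w → M ∙ v ⊨ φ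
M ∙ w ⊨ ⟦ U@(record { pre = preU }) , s ⟧ φ =
  (h : M ∙ w ⊨ preU s) →
  product M U (λ v t → M ∙ v ⊨ preU t) ∙ ((w , s) , [ h ]) ⊨ φ

infixl 10 _⊗_

_⊗_ : KripkeModel Agt Letter → ActionModel Agt (Form Agt Letter) →
      KripkeModel Agt Letter
M ⊗ U = product M U (λ v t → M ∙ v ⊨ pre U t)

module _ (M : KripkeModel Agt Letter) (U : ActionModel Agt (Form Agt Letter)) where

  worldOf : World (M ⊗ U) → World M
  worldOf x = proj₁ (value x)

  eventOf : World (M ⊗ U) → Event U
  eventOf x = proj₂ (value x)

⊨_ : Form Agt Letter → Set₁
⊨_ {Agt} {Letter} φ = (M : KripkeModel Agt Letter) (w : World M) → M ∙ w ⊨ φ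

SameFormulas : (M : KripkeModel Agt Letter) → World M →
               (N : KripkeModel Agt Letter) → World N → Set₁
SameFormulas {Agt} {Letter} M w N v =
  (φ : Form Agt Letter) → (M ∙ w ⊨ φ) ⇔ (N ∙ v ⊨ φ)

module _ {A : Set a} (_⇝_ : Rel A ℓ) where

  Progression : List⁺ A → Set (a ⊔ ℓ)
  Progression xs = Linked _⇝_ (toList xs)

  PastExtension : (ys xs : List⁺ A) → Set (a ⊔ ℓ)
  PastExtension ys xs = Progression ys × (∃[ zs ] ys ≡ zs ++⁺ xs)

  ProperPastExtension : (ys xs : List⁺ A) → Set (a ⊔ ℓ)
  ProperPastExtension ys xs =
    Progression ys × (∃[ zs ] (zs ≢ [] × ys ≡ zs ++⁺ xs))

  History : List⁺ A → Set (a ⊔ ℓ)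
  History xs = Progression xs × ¬ (∃[ ys ] ProperPastExtension ys xs)

module _ (U : ActionModel Agt (Form Agt Letter)) where

  EpistemicPastState : Event U → Set₁
  EpistemicPastState s =
    PastState U s × (⊨ pre U s) × (∀ a t → arrowᵁ U a s t ⇔ (t ≡ s))

  HistoryPreserving : Set₁
  HistoryPreserving =
    (∀ s' s → ydayᵁ U s' s → ⊨ (pre U s ⇒ pre U s')) ×
    (∀ s → PastState U s → EpistemicPastState s)

  PastPreserving : Event U → Set₁
  PastPreserving s =
    HistoryPreserving ×
    (∀ xs → Progression (ydayᵁ U) xs → last xs ≡ s →
      ∃[ ys ] (PastExtension (ydayᵁ U) ys xs × History (ydayᵁ U) ys ×
               EpistemicPastState (head ys)))

{-# OPTIONS --safe #-}
-- Truth is invariant under bisimulations that also match yesterdays, because a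
-- bisimulation between M and N induces one between M[U] and N[U] that keeps the
-- event fixed. If s is an epistemic past state, then (v, s) ↦ v is such a
-- bisimulation from M[U] to M: the precondition of s holds everywhere, s only
-- sees itself, and all yesterdays of (v, s) come from yesterdays of v. This is (a).
-- For (b), extend s to a history s₀ ⇝ … ⇝ s in U. Preconditions are inherited
-- by yesterdays, so all pairs (w, sᵢ) are worlds of M[U], and (a) applies to s₀.
module Submission where

open import Defs
open import Data.Empty using (⊥-elim)
open import Data.Irrelevant using ([_])
open import Data.List.Base as List using ([]; _∷_)
open import Data.List.NonEmpty.Base using (List⁺; _∷_; _∷⁺_; _++⁺_; head; last; map)
open import Data.List.NonEmpty.Relation.Unary.All using (All; _∷_)
open import Data.List.Relation.Unary.All using ([]; _∷_)
open import Data.List.Relation.Unary.Linked as Linked using ([-]; _∷_)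
open import Data.Product.Base using (∃-syntax; Σ-syntax; _×_; _,_; proj₁; proj₂)
open import Data.Refinement.Base using (_,_)
open import Data.Sum.Base using (inj₁; inj₂)
open import Function.Base using (_∘_)
open import Function.Bundles using (_⇔_; mk⇔; module Equivalence)
open import Level using (Level)
open import Relation.Binary.Core using (Rel)
open import Relation.Binary.PropositionalEquality.Core using (_≡_; refl; sym; trans; subst)
open import Relation.Nullary.Negation.Core using (¬_; Stable)

open Equivalence using (to; from)

private
  variable
    a ℓ : Level
    A : Set a
    Agt Letter : Set

-- `φ ⇒ ψ` is a negated conjunction, so modus ponens for it rests on this. Each connective preserves
-- stability, and products are again models with a stable valuation, which covers the action
-- modality.
⊨-stable : (M : KripkeModel Agt Letter) (w : World M) (φ : Form Agt Letter) →
           Stable (M ∙ w ⊨ φ)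
⊨-stable M w (var p)       ¬¬φ = V-stable M p w ¬¬φ
⊨-stable M w (~ φ)         ¬¬φ = λ t → ¬¬φ (λ f → f t)
⊨-stable M w (φ ∧ ψ)       ¬¬φ =
  ⊨-stable M w φ (λ n → ¬¬φ (n ∘ proj₁)) ,
  ⊨-stable M w ψ (λ n → ¬¬φ (n ∘ proj₂))
⊨-stable M w (□ a φ)       ¬¬φ =
  λ v r → ⊨-stable M v φ (λ n → ¬¬φ (λ f → n (f v r)))
⊨-stable M w ([Y] φ)       ¬¬φ =
  λ v r → ⊨-stable M v φ (λ n → ¬¬φ (λ f → n (f v r)))
⊨-stable M w (⟦ U , s ⟧ φ) ¬¬φ =
  λ h → ⊨-stable (M ⊗ U) ((w , s) , [ h ]) φ (λ n → ¬¬φ (λ f → n (f h)))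

⇒-elim : (M : KripkeModel Agt Letter) (w : World M) (φ ψ : Form Agt Letter) →
         M ∙ w ⊨ φ ⇒ ψ → M ∙ w ⊨ φ → M ∙ w ⊨ ψ
⇒-elim M w φ ψ φ⇒ψ p = ⊨-stable M w ψ (λ ¬q → φ⇒ψ (p , ¬q))

record Bisimulation (M N : KripkeModel Agt Letter) : Set₁ where
  field
    _∼_         : World M → World N → Set
    atoms       : ∀ {w v} → w ∼ v → ∀ p → V M p w ⇔ V N p v
    arrow-forth : ∀ {w v} → w ∼ v → ∀ a w' → arrow M a w w' →
                  ∃[ v' ] (arrow N a v v' × w' ∼ v')
    arrow-back  : ∀ {w v} → w ∼ v → ∀ a v' → arrow N a v v' →
                  ∃[ w' ] (arrow M a w w' × w' ∼ v')
    yday-forth  : ∀ {w v} → w ∼ v → ∀ w' → yday M w' w →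
                  ∃[ v' ] (yday N v' v × w' ∼ v')
    yday-back   : ∀ {w v} → w ∼ v → ∀ v' → yday N v' v →
                  ∃[ w' ] (yday M w' w × w' ∼ v')

open Bisimulation

-- `P` and `Q` stay abstract so that this applies in the middle of the induction on formulas, where
-- invariance of the preconditions is only an induction hypothesis.
product-bisimulation :
  {F : Set₁} {M N : KripkeModel Agt Letter} (U : ActionModel Agt F)
  {P : World M → Event U → Set} {Q : World N → Event U → Set}
  (B : Bisimulation M N) →
  (∀ {w v} → _∼_ B w v → ∀ t → P w t ⇔ Q v t) →
  Bisimulation (product M U P) (product N U Q)
product-bisimulation U B P⇔Q = record
  { _∼_         = λ { ((w , t) , _) ((v , u) , _) → _∼_ B w v × t ≡ u }
  ; atoms       = λ { (b , _) → atoms B b }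
  ; arrow-forth = λ { (b , refl) a ((w' , t') , [ h ]) (r , e) →
      let (v' , r' , b') = arrow-forth B b a w' r
      in ((v' , t') , [ to (P⇔Q b' t') h ]) , (r' , e) , (b' , refl) }
  ; arrow-back  = λ { (b , refl) a ((v' , t') , [ h ]) (r , e) →
      let (w' , r' , b') = arrow-back B b a v' r
      in ((w' , t') , [ from (P⇔Q b' t') h ]) , (r' , e) , (b' , refl) }
  ; yday-forth  = λ
      { (b , refl) ((w' , t) , [ h ]) (inj₁ (r , refl , past)) →
          let (v' , r' , b') = yday-forth B b w' r
          in ((v' , t) , [ to (P⇔Q b' t) h ]) , inj₁ (r' , refl , past) , (b' , refl)
      -- The world stays put and only the event moves, so `b` itself relates the new pairs.
      ; (b , refl) ((w , t') , [ h ]) (inj₂ (refl , e)) →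
          ((_ , t') , [ to (P⇔Q b t') h ]) , inj₂ (refl , e) , (b , refl) }
  ; yday-back   = λ
      { (b , refl) ((v' , t) , [ h ]) (inj₁ (r , refl , past)) →
          let (w' , r' , b') = yday-back B b v' r
          in ((w' , t) , [ from (P⇔Q b' t) h ]) , inj₁ (r' , refl , past) , (b' , refl)
      ; (b , refl) ((v , t') , [ h ]) (inj₂ (refl , e)) →
          ((_ , t') , [ from (P⇔Q b t') h ]) , inj₂ (refl , e) , (b , refl) }
  }

-- Induction on the formula with `B` varying, since the action modality replaces both models by
-- their products.
bisimilar⇒sameFormulas : {M N : KripkeModel Agt Letter} (B : Bisimulation M N) →
                         ∀ {w v} → _∼_ B w v → SameFormulas M w N v
bisimilar⇒sameFormulas B b (var p) = atoms B b p
bisimilar⇒sameFormulas B b (~ φ) = mk⇔ (_∘ from ih) (_∘ to ih)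
  where ih = bisimilar⇒sameFormulas B b φ
bisimilar⇒sameFormulas B b (φ ∧ ψ) =
  mk⇔ (λ (p , q) → to ihφ p , to ihψ q) (λ (p , q) → from ihφ p , from ihψ q)
  where
  ihφ = bisimilar⇒sameFormulas B b φ
  ihψ = bisimilar⇒sameFormulas B b ψ
bisimilar⇒sameFormulas B b (□ a φ) = mk⇔
  (λ f v' r → let (w' , r' , b') = arrow-back B b a v' r
              in to (bisimilar⇒sameFormulas B b' φ) (f w' r'))
  (λ f w' r → let (v' , r' , b') = arrow-forth B b a w' r
              in from (bisimilar⇒sameFormulas B b' φ) (f v' r'))
bisimilar⇒sameFormulas B b ([Y] φ) = mk⇔
  (λ f v' r → let (w' , r' , b') = yday-back B b v' r
              in to (bisimilar⇒sameFormulas B b' φ) (f w' r'))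
  (λ f w' r → let (v' , r' , b') = yday-forth B b w' r
              in from (bisimilar⇒sameFormulas B b' φ) (f v' r'))
-- Matching on the field `pre` exposes `preU t` as a subterm, so that recursion into preconditions
-- is structural.
bisimilar⇒sameFormulas {M = M} {N} B b (⟦ U@(record { pre = preU }) , s ⟧ φ) = mk⇔
  (λ f h → to (bisimilar⇒sameFormulas B⊗U (b , refl) φ) (f (from (ih b s) h)))
  (λ f h → from (bisimilar⇒sameFormulas B⊗U (b , refl) φ) (f (to (ih b s) h)))
  where
  ih : ∀ {w v} → _∼_ B w v → ∀ t → (M ∙ w ⊨ preU t) ⇔ (N ∙ v ⊨ preU t)
  ih b' t = bisimilar⇒sameFormulas B b' (preU t)
  B⊗U : Bisimulation (M ⊗ U) (N ⊗ U)
  B⊗U = product-bisimulation U B ih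

module _ (M : KripkeModel Agt Letter) (U : ActionModel Agt (Form Agt Letter)) where

  epistemicPastState-bisimulation : ∀ s → EpistemicPastState U s → Bisimulation (M ⊗ U) M
  epistemicPastState-bisimulation s (past , valid , loops) = record
    { _∼_         = λ x v → worldOf M U x ≡ v × eventOf M U x ≡ s
    ; atoms       = λ { (refl , _) p → mk⇔ (λ q → q) (λ q → q) }
    ; arrow-forth = λ { (refl , refl) a x' (r , e) →
        worldOf M U x' , r , (refl , to (loops a _) e) }
    ; arrow-back  = λ { (refl , refl) a v' r →
        ((v' , s) , [ valid M v' ]) , (r , from (loops a s) refl) , (refl , refl) }
    ; yday-forth  = λ
        { (refl , refl) x' (inj₁ (r , e , _)) → worldOf M U x' , r , (refl , e)
        ; (refl , refl) x' (inj₂ (_ , e))     → ⊥-elim (past (_ , e)) }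
    ; yday-back   = λ { (refl , refl) v' r →
        ((v' , s) , [ valid M v' ]) , inj₁ (r , refl , past) , (refl , refl) }
    }

  epistemicPastState-sameFormulas : ∀ x → EpistemicPastState U (eventOf M U x) →
                                    SameFormulas (M ⊗ U) x M (worldOf M U x)
  epistemicPastState-sameFormulas x eps =
    bisimilar⇒sameFormulas (epistemicPastState-bisimulation _ eps) (refl , refl)

last-∷⁺ : ∀ (x : A) xs → last (x ∷⁺ xs) ≡ last xs
-- Both sides reduce once the `initLast` view of the tail is known.
last-∷⁺ x (y ∷ ys) with List.initLast ys
... | []            = refl
... | zs List.∷ʳ′ z = refl

noPredecessor⇒history : {R : Rel A ℓ} (xs : List⁺ A) → Progression R xs →
                        ¬ (∃[ y ] R y (head xs)) → History R xs
noPredecessor⇒history {R = R} xs prog noPred =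
  prog , λ { (_ , prog' , zs , zs≢[] , refl) → zs≢[] (prefix-empty zs prog') }
  where
  prefix-empty : ∀ zs → Progression R (zs ++⁺ xs) → zs ≡ []
  prefix-empty []        _ = refl
  -- Once the rest of the prefix is known to be empty, `z` stands directly before `head xs`.
  prefix-empty (z ∷ zs)  prog' with prefix-empty zs (Linked.tail prog')
  prefix-empty (z ∷ .[]) (r ∷ _) | refl = ⊥-elim (noPred (z , r))

module _ (M : KripkeModel Agt Letter) (U : ActionModel Agt (Form Agt Letter))
         (x : World (M ⊗ U)) where

  -- A list of worlds is asked for, not computed from `ts`: each member carries a proof of its
  -- precondition, which comes from its successor.
  Lifting : List⁺ (Event U) → Set
  Lifting ts = Σ[ xs ∈ List⁺ (World (M ⊗ U)) ]
    (All (λ y → worldOf M U y ≡ worldOf M U x) xs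
    × last xs ≡ x
    × Progression (yday (M ⊗ U)) xs
    × map (eventOf M U) xs ≡ ts)

  module _ (inherit : ∀ s' s → ydayᵁ U s' s → ⊨ (pre U s ⇒ pre U s')) where

    -- The precondition passes from the head event `u` to its yesterday `t` at the same world `v`,
    -- so `(v , t)` survives in `M ⊗ U` and precedes the old head by an event step.
    lifting-∷⁺ : ∀ t ts → Progression (ydayᵁ U) (t ∷⁺ ts) → Lifting ts → Lifting (t ∷⁺ ts)
    lifting-∷⁺ t _ (r ∷ _) (xs@(((v , u) , [ h ]) ∷ _) , (v≡ ∷ vs≡) , last≡ , prog , refl) =
      y ∷⁺ xs ,
      (v≡ ∷ v≡ ∷ vs≡) ,
      trans (last-∷⁺ y xs) last≡ ,
      inj₂ (refl , r) ∷ prog ,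
      refl
      where
      y : World (M ⊗ U)
      y = (v , t) , [ ⇒-elim M v (pre U u) (pre U t) (inherit t u r M v) h ]

    lift-progression : ∀ ts → Progression (ydayᵁ U) (ts ++⁺ (eventOf M U x ∷ [])) →
                       Lifting (ts ++⁺ (eventOf M U x ∷ []))
    lift-progression []       _    = x ∷ [] , (refl ∷ []) , refl , [-] , refl
    lift-progression (t ∷ ts) prog =
      lifting-∷⁺ t _ prog (lift-progression ts (Linked.tail prog))

theorem18 : (Agt : Set) → NonemptyFinite Agt →
    (Letter : Set) → Letter →
    (M : KripkeModel Agt Letter) (w : World M)
    (U : ActionModel Agt (Form Agt Letter)) (s : Event U)
    (h : M ∙ w ⊨ pre U s) →
    (EpistemicPastState U s →
    SameFormulas (M ⊗ U) ((w , s) , [ h ]) M w)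
    ×
    (PastPreserving U s →
    Σ[ xs ∈ List⁺ (World (M ⊗ U)) ]
    (All (λ x → worldOf M U x ≡ w) xs
    × last xs ≡ ((w , s) , [ h ])
    × Progression (yday (M ⊗ U)) xs
    -- Not a history in M ⊗ U outright: a yesterday w' of w in M gives
    -- the yesterday (w' , s₀) of the first element (w , s₀).
    × History (ydayᵁ U) (map (eventOf M U) xs)
    × (¬ (∃[ w' ] yday M w' w) → History (yday (M ⊗ U)) xs)
    × SameFormulas (M ⊗ U) (head xs) M w))
theorem18 Agt _ Letter _ M w U s h =
  epistemicPastState-sameFormulas M U x , λ ((inherit , _) , extend) →
    -- Past preservation is applied to the one-element progression `s`; its extension has the form
    -- `ts ++⁺ (s ∷ [])` that `lift-progression` expects.
    let (_ , (prog , ts , ys≡) , hist , eps) = extend (s ∷ []) [-] refl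
    in conclude (subst (Lifting M U x) (sym ys≡)
                  (lift-progression M U x inherit ts
                    (subst (Progression (ydayᵁ U)) ys≡ prog)))
                hist eps
  where
  x : World (M ⊗ U)
  x = (w , s) , [ h ]

  conclude : ∀ {ys} → Lifting M U x ys →
             History (ydayᵁ U) ys → EpistemicPastState U (head ys) →
             Σ[ xs ∈ List⁺ (World (M ⊗ U)) ]
             (All (λ x → worldOf M U x ≡ w) xs
             × last xs ≡ x
             × Progression (yday (M ⊗ U)) xs
             × History (ydayᵁ U) (map (eventOf M U) xs)
             × (¬ (∃[ w' ] yday M w' w) → History (yday (M ⊗ U)) xs)
             × SameFormulas (M ⊗ U) (head xs) M w)
  -- The matches identify `w` with the world of `head xs` and `ys` with the events of `xs`, so
  -- `hist` and `eps` now speak about `xs`.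
  conclude (xs , worlds@(refl ∷ _) , last≡ , prog , refl) hist eps@(past , _) =
    xs , worlds , last≡ , prog , hist ,
    -- A yesterday of the head comes from a yesterday of `w` or of the first event; `noYday` and
    -- `past` exclude these in turn.
    (λ noYday → noPredecessor⇒history xs prog λ
      { (y , inj₁ (r , _)) → noYday (_ , r)
      ; (y , inj₂ (_ , e)) → past (_ , e) }) ,
    epistemicPastState-sameFormulas M U (head xs) eps
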